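{- Let $n$ be a positive integer and let $\alpha,\beta,\gamma,\delta: \mathcal{P}(n) \to [0,\infty)$ satisfy \[ \alpha(A)\beta(B) \leq \gamma(A \cup B)\,\delta(A \cap B) \quad \text{for all } A,B \in \mathcal{P}(n). \] Then \[ \sum_{A \in \mathcal{P}(n)}\alpha(A)\beta(A^c) \leq \sum_{C \in \mathcal{P}(n)}\gamma(C)\delta(C^c). \]
   Context: $[n]=\{1,\dots,n\}$, $\mathcal{P}(n)$ denotes the power set of $[n]$, and $A^c = [n]\setminus A$ denotes the complement of $A$ in $[n]$. -}

module Defs where

open import Algebra.Bundles using (CommutativeMonoid)
import Algebra.Properties.CommutativeSemigroup as CommutativeSemigroupProperties
open import Data.Fin.Subset using (Subset; inside; outside)
open import Data.Nat as ℕ using (ℕ; zero; suc)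
import Data.Nat.Properties as ℕ
open import Data.Product using (∃-syntax; _×_; _,_)
open import Data.Rational as ℚ using (ℚ; 0ℚ; 1ℚ; ½)
import Data.Rational.Properties as ℚ
open import Data.Vec using ([]; _∷_)
open import Relation.Binary.PropositionalEquality
  using (_≡_; refl; sym; trans; cong; cong₂; subst)

-- A real number is represented by a Cauchy sequence of rationals together with
-- a modulus of convergence (the Σ-type hidden in ∃[ N ]).  Reals are not
-- quotiented: different sequences may represent the same number, and _≤_ below
-- compares the numbers represented.

IsCauchy : (ℕ → ℚ) → Set
IsCauchy s = ∀ ε → 0ℚ ℚ.< ε →
  ∃[ N ] (∀ m n → N ℕ.≤ m → N ℕ.≤ n → ℚ.∣ s m ℚ.- s n ∣ ℚ.< ε)

record ℝ : Set where
  constructor mkℝ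
  field
    seq    : ℕ → ℚ
    cauchy : IsCauchy seq

open ℝ public

module Cauchy where

  open CommutativeSemigroupProperties
    (CommutativeMonoid.commutativeSemigroup ℚ.+-0-commutativeMonoid) using (interchange)

  ½*-pos : ∀ {ε} → 0ℚ ℚ.< ε → 0ℚ ℚ.< ½ ℚ.* ε
  ½*-pos {ε} 0<ε = ℚ.*-monoʳ-<-pos ½ 0<ε

  ½+½ : ∀ ε → ½ ℚ.* ε ℚ.+ ½ ℚ.* ε ≡ ε
  ½+½ ε = trans (sym (ℚ.*-distribʳ-+ ε ½ ½)) (ℚ.*-identityˡ ε)

  split : ∀ a b → a ≡ (a ℚ.- b) ℚ.+ b
  split a b = sym (trans (ℚ.+-assoc a (ℚ.- b) b)
    (trans (cong (a ℚ.+_) (ℚ.+-inverseˡ b)) (ℚ.+-identityʳ a)))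

  *-distribˡ-- : ∀ a b c → a ℚ.* (b ℚ.- c) ≡ a ℚ.* b ℚ.- a ℚ.* c
  *-distribˡ-- a b c = trans (ℚ.*-distribˡ-+ a b (ℚ.- c))
    (cong (a ℚ.* b ℚ.+_) (sym (ℚ.neg-distribʳ-* a c)))

  const-cauchy : ∀ q → IsCauchy (λ _ → q)
  const-cauchy q ε 0<ε = 0 , λ _ _ _ _ →
    subst (ℚ._< ε) (sym (cong ℚ.∣_∣ (ℚ.+-inverseʳ q))) 0<ε

  +-cauchy : ∀ s t → IsCauchy s → IsCauchy t → IsCauchy (λ n → s n ℚ.+ t n)
  +-cauchy s t cs ct ε 0<ε
    with cs (½ ℚ.* ε) (½*-pos 0<ε) | ct (½ ℚ.* ε) (½*-pos 0<ε)
  ... | M , p | N , q = M ℕ.⊔ N , λ m n le le′ → begin-strict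
    ℚ.∣ (s m ℚ.+ t m) ℚ.- (s n ℚ.+ t n) ∣
      ≡⟨ cong ℚ.∣_∣ (rearrange (s m) (t m) (s n) (t n)) ⟩
    ℚ.∣ (s m ℚ.- s n) ℚ.+ (t m ℚ.- t n) ∣
      ≤⟨ ℚ.∣p+q∣≤∣p∣+∣q∣ (s m ℚ.- s n) (t m ℚ.- t n) ⟩
    ℚ.∣ s m ℚ.- s n ∣ ℚ.+ ℚ.∣ t m ℚ.- t n ∣
      <⟨ ℚ.+-mono-< (p m n (ℕ.m⊔n≤o⇒m≤o M N le) (ℕ.m⊔n≤o⇒m≤o M N le′))
                    (q m n (ℕ.m⊔n≤o⇒n≤o M N le) (ℕ.m⊔n≤o⇒n≤o M N le′)) ⟩
    ½ ℚ.* ε ℚ.+ ½ ℚ.* ε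
      ≡⟨ ½+½ ε ⟩
    ε ∎
    where
    open ℚ.≤-Reasoning
    rearrange : ∀ a b c d → (a ℚ.+ b) ℚ.- (c ℚ.+ d) ≡ (a ℚ.- c) ℚ.+ (b ℚ.- d)
    rearrange a b c d = trans
      (cong ((a ℚ.+ b) ℚ.+_) (ℚ.neg-distrib-+ c d))
      (interchange a b (ℚ.- c) (ℚ.- d))

  eventually-bounded : ∀ s → IsCauchy s →
    ∃[ K ] (0ℚ ℚ.< K × (∃[ N ] (∀ n → N ℕ.≤ n → ℚ.∣ s n ∣ ℚ.≤ K)))
  eventually-bounded s cs with cs 1ℚ (ℚ.positive⁻¹ 1ℚ)
  ... | N , p = 1ℚ ℚ.+ ℚ.∣ s N ∣ , 0<K , N , λ n le → begin
    ℚ.∣ s n ∣                           ≡⟨ cong ℚ.∣_∣ (split (s n) (s N)) ⟩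
    ℚ.∣ (s n ℚ.- s N) ℚ.+ s N ∣         ≤⟨ ℚ.∣p+q∣≤∣p∣+∣q∣ (s n ℚ.- s N) (s N) ⟩
    ℚ.∣ s n ℚ.- s N ∣ ℚ.+ ℚ.∣ s N ∣     ≤⟨ ℚ.+-monoˡ-≤ ℚ.∣ s N ∣ (ℚ.<⇒≤ (p n N le ℕ.≤-refl)) ⟩
    1ℚ ℚ.+ ℚ.∣ s N ∣                    ∎
    where
    open ℚ.≤-Reasoning
    0<K : 0ℚ ℚ.< 1ℚ ℚ.+ ℚ.∣ s N ∣
    0<K = ℚ.+-mono-<-≤ (ℚ.positive⁻¹ 1ℚ) (ℚ.0≤∣p∣ (s N))

  quotient : ∀ {ε K} → 0ℚ ℚ.< ε → 0ℚ ℚ.< K → ∃[ δ ] (0ℚ ℚ.< δ × K ℚ.* δ ≡ ε)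
  quotient {ε} {K} 0<ε 0<K = K⁻¹ ℚ.* ε , 0<δ , eq
    where
    instance
      K-pos = ℚ.positive 0<K
      K-nonZero = ℚ.pos⇒nonZero K
    K⁻¹ : ℚ
    K⁻¹ = ℚ.1/ K
    0<δ : 0ℚ ℚ.< K⁻¹ ℚ.* ε
    0<δ = subst (ℚ._< K⁻¹ ℚ.* ε) (ℚ.*-zeroʳ K⁻¹)
            (ℚ.*-monoʳ-<-pos K⁻¹ {{ℚ.1/pos⇒pos K}} 0<ε)
    eq : K ℚ.* (K⁻¹ ℚ.* ε) ≡ ε
    eq = trans (sym (ℚ.*-assoc K K⁻¹ ε))
           (trans (cong (ℚ._* ε) (ℚ.*-inverseʳ K)) (ℚ.*-identityˡ ε))

  *-mono-≤-< : ∀ {a K d δ} → 0ℚ ℚ.< K → a ℚ.≤ K → 0ℚ ℚ.≤ d → d ℚ.< δ →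
               a ℚ.* d ℚ.< K ℚ.* δ
  *-mono-≤-< {a} {K} {d} {δ} 0<K a≤K 0≤d d<δ = ℚ.≤-<-trans
    (ℚ.*-monoʳ-≤-nonNeg d {{ℚ.nonNegative 0≤d}} a≤K)
    (ℚ.*-monoʳ-<-pos K {{ℚ.positive 0<K}} d<δ)

  *-cauchy : ∀ s t → IsCauchy s → IsCauchy t → IsCauchy (λ n → s n ℚ.* t n)
  *-cauchy s t cs ct ε 0<ε
    with eventually-bounded s cs | eventually-bounded t ct
  ... | K , 0<K , B , s≤K | L , 0<L , C , t≤L
    with quotient 0<ε (ℚ.+-mono-< 0<K 0<L)
  ... | δ , 0<δ , eq
    with cs δ 0<δ | ct δ 0<δ
  ... | M , p | N , q = (B ℕ.⊔ C) ℕ.⊔ (M ℕ.⊔ N) , λ m n le le′ → begin-strict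
    ℚ.∣ s m ℚ.* t m ℚ.- s n ℚ.* t n ∣
      ≡⟨ cong ℚ.∣_∣ (rearrange (s m) (t m) (s n) (t n)) ⟩
    ℚ.∣ s m ℚ.* (t m ℚ.- t n) ℚ.+ t n ℚ.* (s m ℚ.- s n) ∣
      ≤⟨ ℚ.∣p+q∣≤∣p∣+∣q∣ (s m ℚ.* (t m ℚ.- t n)) (t n ℚ.* (s m ℚ.- s n)) ⟩
    ℚ.∣ s m ℚ.* (t m ℚ.- t n) ∣ ℚ.+ ℚ.∣ t n ℚ.* (s m ℚ.- s n) ∣
      ≡⟨ cong₂ ℚ._+_ (ℚ.∣p*q∣≡∣p∣*∣q∣ (s m) (t m ℚ.- t n))
                     (ℚ.∣p*q∣≡∣p∣*∣q∣ (t n) (s m ℚ.- s n)) ⟩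
    ℚ.∣ s m ∣ ℚ.* ℚ.∣ t m ℚ.- t n ∣ ℚ.+ ℚ.∣ t n ∣ ℚ.* ℚ.∣ s m ℚ.- s n ∣
      <⟨ ℚ.+-mono-<
           (*-mono-≤-< 0<K (s≤K m (inB le)) (ℚ.0≤∣p∣ (t m ℚ.- t n)) (q m n (inN le) (inN le′)))
           (*-mono-≤-< 0<L (t≤L n (inC le′)) (ℚ.0≤∣p∣ (s m ℚ.- s n)) (p m n (inM le) (inM le′))) ⟩
    K ℚ.* δ ℚ.+ L ℚ.* δ
      ≡⟨ sym (ℚ.*-distribʳ-+ δ K L) ⟩
    (K ℚ.+ L) ℚ.* δ
      ≡⟨ eq ⟩
    ε ∎
    where
    open ℚ.≤-Reasoning
    rearrange : ∀ a b c d → a ℚ.* b ℚ.- c ℚ.* d ≡ a ℚ.* (b ℚ.- d) ℚ.+ d ℚ.* (a ℚ.- c)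
    rearrange a b c d = sym (begin-equality
      a ℚ.* (b ℚ.- d) ℚ.+ d ℚ.* (a ℚ.- c)
        ≡⟨ cong₂ ℚ._+_ (*-distribˡ-- a b d) (*-distribˡ-- d a c) ⟩
      (a ℚ.* b ℚ.- a ℚ.* d) ℚ.+ (d ℚ.* a ℚ.- d ℚ.* c)
        ≡⟨ cong₂ (λ u v → (a ℚ.* b ℚ.- a ℚ.* d) ℚ.+ (u ℚ.- v)) (ℚ.*-comm d a) (ℚ.*-comm d c) ⟩
      (a ℚ.* b ℚ.- a ℚ.* d) ℚ.+ (a ℚ.* d ℚ.- c ℚ.* d)
        ≡⟨ sym (ℚ.+-assoc (a ℚ.* b ℚ.- a ℚ.* d) (a ℚ.* d) (ℚ.- (c ℚ.* d))) ⟩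
      (a ℚ.* b ℚ.- a ℚ.* d) ℚ.+ a ℚ.* d ℚ.- c ℚ.* d
        ≡⟨ cong (ℚ._- c ℚ.* d) (sym (split (a ℚ.* b) (a ℚ.* d))) ⟩
      a ℚ.* b ℚ.- c ℚ.* d ∎)
    inB : ∀ {k} → (B ℕ.⊔ C) ℕ.⊔ (M ℕ.⊔ N) ℕ.≤ k → B ℕ.≤ k
    inB le = ℕ.m⊔n≤o⇒m≤o B C (ℕ.m⊔n≤o⇒m≤o (B ℕ.⊔ C) (M ℕ.⊔ N) le)
    inC : ∀ {k} → (B ℕ.⊔ C) ℕ.⊔ (M ℕ.⊔ N) ℕ.≤ k → C ℕ.≤ k
    inC le = ℕ.m⊔n≤o⇒n≤o B C (ℕ.m⊔n≤o⇒m≤o (B ℕ.⊔ C) (M ℕ.⊔ N) le)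
    inM : ∀ {k} → (B ℕ.⊔ C) ℕ.⊔ (M ℕ.⊔ N) ℕ.≤ k → M ℕ.≤ k
    inM le = ℕ.m⊔n≤o⇒m≤o M N (ℕ.m⊔n≤o⇒n≤o (B ℕ.⊔ C) (M ℕ.⊔ N) le)
    inN : ∀ {k} → (B ℕ.⊔ C) ℕ.⊔ (M ℕ.⊔ N) ℕ.≤ k → N ℕ.≤ k
    inN le = ℕ.m⊔n≤o⇒n≤o M N (ℕ.m⊔n≤o⇒n≤o (B ℕ.⊔ C) (M ℕ.⊔ N) le)

open Cauchy

infixl 7 _*_
infixl 6 _+_
infix  4 _≤_

0ℝ : ℝ
0ℝ = mkℝ (λ _ → 0ℚ) (const-cauchy 0ℚ)

_+_ : ℝ → ℝ → ℝ
x + y = mkℝ (λ n → seq x n ℚ.+ seq y n) (+-cauchy (seq x) (seq y) (cauchy x) (cauchy y))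

_*_ : ℝ → ℝ → ℝ
x * y = mkℝ (λ n → seq x n ℚ.* seq y n) (*-cauchy (seq x) (seq y) (cauchy x) (cauchy y))

-- lim x ≤ lim y.  The slack ε cannot be dropped: a limit inequality does not
-- give a termwise one, even eventually.
_≤_ : ℝ → ℝ → Set
x ≤ y = ∀ ε → 0ℚ ℚ.< ε →
  ∃[ N ] (∀ n → N ℕ.≤ n → seq x n ℚ.≤ seq y n ℚ.+ ε)

-- The sum of f over all subsets of Fin n, split on whether the subset
-- contains the first element.
∑ : ∀ {n} → (Subset n → ℝ) → ℝ
∑ {zero}  f = f []
∑ {suc n} f = ∑ (λ A → f (outside ∷ A)) + ∑ (λ A → f (inside ∷ A))

{-# OPTIONS --safe #-}

-- Put f A = α A * β (∁ A) and g C = γ C * δ (∁ C).  Regrouping the factors of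
-- f A * f (∁ B) as (α A * β B) * (α (∁ B) * β (∁ A)) and using the hypothesis
-- twice gives f A * f (∁ B) ≤ g (A ∪ B) * g (∁ (A ∩ B)).  The four functions
-- theorem of Ahlswede and Daykin, applied to f, f ∘ ∁, g, g ∘ ∁, then yields
-- (∑ f)² ≤ (∑ g)², whence ∑ f ≤ ∑ g.

module Submission where

open import Defs
open import Algebra.Lattice.Properties.BooleanAlgebra
  using (deMorgan₁; deMorgan₂; ¬-involutive)
open import Data.Nat as ℕ using (ℕ; zero; suc; NonZero)
import Data.Nat.Properties as ℕ
open import Data.Fin.Subset using (Subset; _∪_; _∩_; ∁; inside; outside)
open import Data.Fin.Subset.Properties using (∪-∩-booleanAlgebra; ∪-comm; ∩-comm)
open import Data.Product using (∃-syntax; _×_; _,_)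
open import Data.Rational as ℚ using (ℚ; 0ℚ; 1ℚ; ½)
import Data.Rational.Properties as ℚ
open import Data.Rational.Solver using (module +-*-Solver)
open import Data.Sum using (inj₁; inj₂)
open import Data.Vec using ([]; _∷_)
open import Relation.Binary.PropositionalEquality
  using (_≡_; refl; sym; trans; cong; cong₂; subst; subst₂)
open +-*-Solver

-- Inequalities between rationals.

infixl 6 _⊖_

-- Has the shape of the terms of a real difference `x - y`, so that identities from the solver fit
-- the sequences as they stand.
_⊖_ : ∀ {k} → Polynomial k → Polynomial k → Polynomial k
p ⊖ q = p :+ con (ℚ.- 1ℚ) :* q

0≤p*q : ∀ {p q} → 0ℚ ℚ.≤ p → 0ℚ ℚ.≤ q → 0ℚ ℚ.≤ p ℚ.* q
0≤p*q {p} {q} 0≤p 0≤q = ℚ.nonNegative⁻¹ (p ℚ.* q)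
  {{ℚ.nonNeg*nonNeg⇒nonNeg p {{ℚ.nonNegative 0≤p}} q {{ℚ.nonNegative 0≤q}}}}

0≤p+q : ∀ {p q} → 0ℚ ℚ.≤ p → 0ℚ ℚ.≤ q → 0ℚ ℚ.≤ p ℚ.+ q
0≤p+q = ℚ.+-mono-≤

0≤q-p : ∀ {p q} → p ℚ.≤ q → 0ℚ ℚ.≤ q ℚ.- p
0≤q-p {p} {q} p≤q = subst (ℚ._≤ q ℚ.- p) (ℚ.+-inverseʳ p) (ℚ.+-monoˡ-≤ (ℚ.- p) p≤q)

≤-by-difference : ∀ {p q r} → 0ℚ ℚ.≤ r → q ≡ p ℚ.+ r → p ℚ.≤ q
≤-by-difference {p} {q} {r} 0≤r eq =
  subst₂ ℚ._≤_ (ℚ.+-identityʳ p) (sym eq) (ℚ.+-monoʳ-≤ p 0≤r)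

p≤∣p∣ : ∀ p → p ℚ.≤ ℚ.∣ p ∣
p≤∣p∣ p with ℚ.≤-total 0ℚ p
... | inj₁ 0≤p = ℚ.≤-reflexive (sym (ℚ.0≤p⇒∣p∣≡p 0≤p))
... | inj₂ p≤0 = ℚ.≤-trans p≤0 (ℚ.0≤∣p∣ p)

0<p⊓q : ∀ {p q} → 0ℚ ℚ.< p → 0ℚ ℚ.< q → 0ℚ ℚ.< p ℚ.⊓ q
0<p⊓q {p} {q} 0<p 0<q with ℚ.⊓-sel p q
... | inj₁ eq = subst (0ℚ ℚ.<_) (sym eq) 0<p
... | inj₂ eq = subst (0ℚ ℚ.<_) (sym eq) 0<q

-- Order and nonnegativity of reals.

Eventually : (ℕ → Set) → Set
Eventually P = ∃[ N ] (∀ n → N ℕ.≤ n → P n)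

eventually-map : ∀ {P Q : ℕ → Set} → (∀ n → P n → Q n) → Eventually P → Eventually Q
eventually-map f (N , p) = N , λ n le → f n (p n le)

eventually-× : ∀ {P Q : ℕ → Set} → Eventually P → Eventually Q → Eventually (λ n → P n × Q n)
eventually-× (M , p) (N , q) = M ℕ.⊔ N , λ n le →
  p n (ℕ.m⊔n≤o⇒m≤o M N le) , q n (ℕ.m⊔n≤o⇒n≤o M N le)

const : ℚ → ℝ
const q = mkℝ (λ _ → q) (Cauchy.const-cauchy q)

infixl 6 _-_

-- Negation as multiplication by a constant lets the Cauchy property follow from `_+_` and `_*_`.
_-_ : ℝ → ℝ → ℝ
x - y = x + const (ℚ.- 1ℚ) * y

infix 4 _≈_

-- Termwise equality, finer than equality of limits. It suffices because the identities below are
-- polynomial or rearrange finite sums, hence hold at each index.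
_≈_ : ℝ → ℝ → Set
x ≈ y = ∀ n → seq x n ≡ seq y n

-- The relation _≤_ of Defs unfolds on sight, so that x and y cannot be inferred
-- from a proof of x ≤ y; the record makes them inferable.
infix 4 _≼_

record _≼_ (x y : ℝ) : Set where
  constructor wrap
  field unwrap : x ≤ y

open _≼_

-- Reduces an inequality to a nonnegative gap `z` and a termwise identity.
nonNeg⇒≼ : ∀ {x y} z → 0ℝ ≼ z → y ≈ x + z → x ≼ y
nonNeg⇒≼ {x} {y} z 0≼z eq = wrap λ ε 0<ε → eventually-map
  (λ n 0≤zₙ+ε → ≤-by-difference 0≤zₙ+ε
    (trans (cong (ℚ._+ ε) (eq n)) (ℚ.+-assoc (seq x n) (seq z n) ε)))
  (unwrap 0≼z ε 0<ε)

≼⇒nonNeg : ∀ {x y} → x ≼ y → 0ℝ ≼ y - x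
≼⇒nonNeg {x} {y} x≼y = wrap λ ε 0<ε → eventually-map
  (λ n xₙ≤yₙ+ε → subst (0ℚ ℚ.≤_)
    (solve 3 (λ x y ε → (y :+ ε) :- x := (y ⊖ x) :+ ε) refl (seq x n) (seq y n) ε)
    (0≤q-p xₙ≤yₙ+ε))
  (unwrap x≼y ε 0<ε)

≼-resp-≈ : ∀ {x x′ y y′} → x ≈ x′ → y ≈ y′ → x ≼ y → x′ ≼ y′
≼-resp-≈ x≈x′ y≈y′ x≼y = wrap λ ε 0<ε → eventually-map
  (λ n → subst₂ (λ p q → p ℚ.≤ q ℚ.+ ε) (x≈x′ n) (y≈y′ n)) (unwrap x≼y ε 0<ε)

nonNeg-resp-≈ : ∀ {x y} → x ≈ y → 0ℝ ≼ x → 0ℝ ≼ y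
nonNeg-resp-≈ = ≼-resp-≈ λ _ → refl

const-nonNeg : ∀ {q} → 0ℚ ℚ.≤ q → 0ℝ ≼ const q
const-nonNeg 0≤q = wrap λ ε 0<ε → 0 , λ _ _ → 0≤p+q 0≤q (ℚ.<⇒≤ 0<ε)

+-nonNeg : ∀ {x y} → 0ℝ ≼ x → 0ℝ ≼ y → 0ℝ ≼ x + y
+-nonNeg {x} {y} 0≼x 0≼y = wrap λ ε 0<ε → eventually-map
  (λ n (p , q) → subst (0ℚ ℚ.≤_)
    (solve 3 (λ x y ε → (x :+ con ½ :* ε) :+ (y :+ con ½ :* ε) := (x :+ y) :+ ε) refl
      (seq x n) (seq y n) ε)
    (0≤p+q p q))
  (eventually-× (unwrap 0≼x (½ ℚ.* ε) (Cauchy.½*-pos 0<ε))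
                (unwrap 0≼y (½ ℚ.* ε) (Cauchy.½*-pos 0<ε)))

-- With K, L bounding x, y and (K + L + 1) δ = ε, the tolerance η = min(δ, 1) works:
-- xy + ε = (x + η)(y + η) + (δ - η)(K + L + 1) + η ((K - x) + (L - y) + (1 - η)).
*-nonNeg : ∀ {x y} → 0ℝ ≼ x → 0ℝ ≼ y → 0ℝ ≼ x * y
*-nonNeg {x} {y} 0≼x 0≼y = wrap eventually-nonNeg
  where
  eventually-nonNeg : 0ℝ ≤ x * y
  eventually-nonNeg ε 0<ε
    with Cauchy.eventually-bounded (seq x) (cauchy x)
       | Cauchy.eventually-bounded (seq y) (cauchy y)
  ... | K , 0<K , x-bound | L , 0<L , y-bound
    with ℚ.+-mono-< (ℚ.+-mono-< 0<K 0<L) (ℚ.positive⁻¹ 1ℚ)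
  ... | 0<K+L+1
    with Cauchy.quotient 0<ε 0<K+L+1
  ... | δ , 0<δ , refl = eventually-map
    (λ n ((p , q) , (x≤K , y≤L)) → subst (0ℚ ℚ.≤_)
      (solve 6 (λ x y K L δ η →
          (x :+ η) :* (y :+ η) :+ (δ :- η) :* (K :+ L :+ con 1ℚ)
            :+ η :* ((K :- x) :+ (L :- y) :+ (con 1ℚ :- η))
          := x :* y :+ (K :+ L :+ con 1ℚ) :* δ) refl
        (seq x n) (seq y n) K L δ η)
      (0≤p+q
        (0≤p+q (0≤p*q p q) (0≤p*q (0≤q-p (ℚ.p⊓q≤p δ 1ℚ)) (ℚ.<⇒≤ 0<K+L+1)))
        (0≤p*q (ℚ.<⇒≤ 0<η)
          (0≤p+q
            (0≤p+q (0≤q-p (ℚ.≤-trans (p≤∣p∣ (seq x n)) x≤K))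
                   (0≤q-p (ℚ.≤-trans (p≤∣p∣ (seq y n)) y≤L)))
            (0≤q-p (ℚ.p⊓q≤q δ 1ℚ))))))
    (eventually-× (eventually-× (unwrap 0≼x η 0<η) (unwrap 0≼y η 0<η))
                  (eventually-× x-bound y-bound))
    where
    η = δ ℚ.⊓ 1ℚ
    0<η = 0<p⊓q 0<δ (ℚ.positive⁻¹ 1ℚ)

-- Stands in for division by w, which may be zero; w + ε is bounded away from zero.
*-cancelˡ-nonNeg : ∀ {w z} → 0ℝ ≼ w →
  (∀ ε → 0ℚ ℚ.< ε → 0ℝ ≼ (w + const ε) * (z + const ε)) → 0ℝ ≼ z
*-cancelˡ-nonNeg {w} {z} 0≼w 0≼[w+ε][z+ε] = wrap eventually-nonNeg
  where
  eventually-nonNeg : 0ℝ ≤ z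
  eventually-nonNeg ε 0<ε = eventually-map
    (λ n (0≤wₙ+½e , 0≤prod) →
      let
        wₙ = seq w n
        zₙ = seq z n
        ½e≤wₙ+e = ≤-by-difference 0≤wₙ+½e
          (solve 2 (λ w e → w :+ e := con ½ :* e :+ (w :+ con ½ :* e)) refl wₙ e)
        -- Since `ε` is `2e`, `(w + e)(z + ε)` is `(w + e)(z + e) + (w + e)e`. The first summand is
        -- at least `-e²/2`, the tolerance chosen below, and the second at least `e²/2`.
        0≤[wₙ+e][zₙ+ε] = subst (0ℚ ℚ.≤_)
          (solve 3 (λ w z ε → let e = con ½ :* ε in
              ((w :+ e) :* (z :+ e) :+ (con ½ :* e) :* e) :+ ((w :+ e) :- con ½ :* e) :* e
              := (w :+ e) :* (z :+ ε)) refl wₙ zₙ ε)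
          (0≤p+q 0≤prod (0≤p*q (0≤q-p ½e≤wₙ+e) (ℚ.<⇒≤ 0<e)))
      in ℚ.*-cancelˡ-≤-pos (wₙ ℚ.+ e) {{ℚ.positive (ℚ.<-≤-trans 0<½e ½e≤wₙ+e)}}
           (subst (ℚ._≤ (wₙ ℚ.+ e) ℚ.* (zₙ ℚ.+ ε)) (sym (ℚ.*-zeroʳ (wₙ ℚ.+ e)))
             0≤[wₙ+e][zₙ+ε]))
    (eventually-× (unwrap 0≼w (½ ℚ.* e) 0<½e)
      (unwrap (0≼[w+ε][z+ε] e 0<e) (½ ℚ.* e ℚ.* e)
        (subst (ℚ._< ½ ℚ.* e ℚ.* e) (ℚ.*-zeroʳ (½ ℚ.* e))
          (ℚ.*-monoʳ-<-pos (½ ℚ.* e) {{ℚ.positive 0<½e}} 0<e))))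
    where
    e = ½ ℚ.* ε
    0<e = Cauchy.½*-pos 0<ε
    0<½e = Cauchy.½*-pos 0<e

-- Monotonicity and cancellation.

+-mono-≼ : ∀ {x x′ y y′} → x ≼ x′ → y ≼ y′ → x + y ≼ x′ + y′
+-mono-≼ {x} {x′} {y} {y′} x≼x′ y≼y′ = nonNeg⇒≼ ((x′ - x) + (y′ - y))
  (+-nonNeg {x′ - x} {y′ - y} (≼⇒nonNeg {x} {x′} x≼x′) (≼⇒nonNeg {y} {y′} y≼y′))
  λ n → solve 4 (λ x x′ y y′ → x′ :+ y′ := (x :+ y) :+ ((x′ ⊖ x) :+ (y′ ⊖ y))) refl
    (seq x n) (seq x′ n) (seq y n) (seq y′ n)

*-mono-≼ : ∀ {x x′ y y′} → 0ℝ ≼ x → 0ℝ ≼ y′ → x ≼ x′ → y ≼ y′ → x * y ≼ x′ * y′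
*-mono-≼ {x} {x′} {y} {y′} 0≼x 0≼y′ x≼x′ y≼y′ = nonNeg⇒≼ ((x′ - x) * y′ + x * (y′ - y))
  (+-nonNeg {(x′ - x) * y′} {x * (y′ - y)}
    (*-nonNeg {x′ - x} {y′} (≼⇒nonNeg {x} {x′} x≼x′) 0≼y′)
    (*-nonNeg {x} {y′ - y} 0≼x (≼⇒nonNeg {y} {y′} y≼y′)))
  λ n → solve 4 (λ x x′ y y′ → x′ :* y′ := x :* y :+ ((x′ ⊖ x) :* y′ :+ x :* (y′ ⊖ y))) refl
    (seq x n) (seq x′ n) (seq y n) (seq y′ n)

-- The factor `x + y` of `y² - x²` is cancelled. With the slack, `(x + y + ε)(y - x + ε) = (y² - x²)
-- + ε(2y + ε)`, and both summands are nonnegative.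
square-cancel-≼ : ∀ {x y} → 0ℝ ≼ x → 0ℝ ≼ y → x * x ≼ y * y → x ≼ y
square-cancel-≼ {x} {y} 0≼x 0≼y x²≼y² = nonNeg⇒≼ (y - x)
  (*-cancelˡ-nonNeg {x + y} {y - x} (+-nonNeg {x} {y} 0≼x 0≼y) λ ε 0<ε →
    let 0≼ε = const-nonNeg (ℚ.<⇒≤ 0<ε) in
    nonNeg-resp-≈ {(y * y - x * x) + const ε * (y + y + const ε)}
      (λ n → solve 3 (λ x y ε →
          (y :* y ⊖ x :* x) :+ ε :* (y :+ y :+ ε)
          := (x :+ y :+ ε) :* ((y ⊖ x) :+ ε)) refl
        (seq x n) (seq y n) ε)
      (+-nonNeg {y * y - x * x} {const ε * (y + y + const ε)} (≼⇒nonNeg {x * x} {y * y} x²≼y²)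
        (*-nonNeg {const ε} {y + y + const ε} 0≼ε
          (+-nonNeg {y + y} {const ε} (+-nonNeg {y} {y} 0≼y 0≼y) 0≼ε))))
  λ n → solve 2 (λ x y → y := x :+ (y ⊖ x)) refl (seq x n) (seq y n)

-- M (M + m - (x + y)) = (M - x)(M - y) + (M m - x y), used with M + ε in place of
-- the factors M.
+-≼-of-*-≼ : ∀ {x y M m} → 0ℝ ≼ M → 0ℝ ≼ m →
  x ≼ M → y ≼ M → x * y ≼ M * m → x + y ≼ M + m
+-≼-of-*-≼ {x} {y} {M} {m} 0≼M 0≼m x≼M y≼M xy≼Mm = nonNeg⇒≼ (M + m - (x + y))
  (*-cancelˡ-nonNeg {M} {M + m - (x + y)} 0≼M λ ε 0<ε →
    let
      0≼ε = const-nonNeg (ℚ.<⇒≤ 0<ε)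
      u = (M - x) + const ε
      v = (M - y) + const ε
      0≼u = +-nonNeg {M - x} {const ε} (≼⇒nonNeg {x} {M} x≼M) 0≼ε
      0≼v = +-nonNeg {M - y} {const ε} (≼⇒nonNeg {y} {M} y≼M) 0≼ε
    in
    nonNeg-resp-≈ {u * v + (M * m - x * y) + const ε * m}
      (λ n → solve 5 (λ x y M m ε →
          ((M ⊖ x) :+ ε) :* ((M ⊖ y) :+ ε) :+ (M :* m ⊖ x :* y) :+ ε :* m
          := (M :+ ε) :* ((M :+ m ⊖ (x :+ y)) :+ ε)) refl
        (seq x n) (seq y n) (seq M n) (seq m n) ε)
      (+-nonNeg {u * v + (M * m - x * y)} {const ε * m}
        (+-nonNeg {u * v} {M * m - x * y} (*-nonNeg {u} {v} 0≼u 0≼v) (≼⇒nonNeg {x * y} {M * m} xy≼Mm))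
        (*-nonNeg {const ε} {m} 0≼ε 0≼m)))
  λ n → solve 4 (λ x y M m → M :+ m := (x :+ y) :+ (M :+ m ⊖ (x :+ y))) refl
    (seq x n) (seq y n) (seq M n) (seq m n)

-- The four functions theorem.

*-interchange : ∀ a b c d → (a * b) * (c * d) ≈ (a * d) * (c * b)
*-interchange a b c d n =
  solve 4 (λ a b c d → (a :* b) :* (c :* d) := (a :* d) :* (c :* b)) refl
    (seq a n) (seq b n) (seq c n) (seq d n)

*-distrib-+-diagonals : ∀ a₀ a₁ b₀ b₁ →
  (a₀ * b₀ + a₁ * b₁) + (a₁ * b₀ + a₀ * b₁) ≈ (a₀ + a₁) * (b₀ + b₁)
*-distrib-+-diagonals a₀ a₁ b₀ b₁ n =
  solve 4 (λ a₀ a₁ b₀ b₁ →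
      (a₀ :* b₀ :+ a₁ :* b₁) :+ (a₁ :* b₀ :+ a₀ :* b₁) := (a₀ :+ a₁) :* (b₀ :+ b₁)) refl
    (seq a₀ n) (seq a₁ n) (seq b₀ n) (seq b₁ n)

-- The diagonal products are bounded one by one. The mixed products `a₁ * b₀` and `a₀ * b₁` are each
-- at most `c₁ * d₀`, and multiplying `h₁₁` by `h₀₀` bounds their product by
-- `(c₁ * d₀) * (c₀ * d₁)`; so `+-≼-of-*-≼` bounds their sum.
four-functions-one-point : ∀ {a₀ a₁ b₀ b₁ c₀ c₁ d₀ d₁} →
  0ℝ ≼ a₁ → 0ℝ ≼ b₁ → 0ℝ ≼ c₀ → 0ℝ ≼ c₁ → 0ℝ ≼ d₀ → 0ℝ ≼ d₁ →
  a₀ * b₀ ≼ c₀ * d₀ → a₀ * b₁ ≼ c₁ * d₀ → a₁ * b₀ ≼ c₁ * d₀ → a₁ * b₁ ≼ c₁ * d₁ →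
  (a₀ + a₁) * (b₀ + b₁) ≼ (c₀ + c₁) * (d₀ + d₁)
four-functions-one-point {a₀} {a₁} {b₀} {b₁} {c₀} {c₁} {d₀} {d₁}
  0≼a₁ 0≼b₁ 0≼c₀ 0≼c₁ 0≼d₀ 0≼d₁ h₀₀ h₀₁ h₁₀ h₁₁ =
  ≼-resp-≈ {(a₀ * b₀ + a₁ * b₁) + (a₁ * b₀ + a₀ * b₁)} {_}
           {(c₀ * d₀ + c₁ * d₁) + (c₁ * d₀ + c₀ * d₁)}
    (*-distrib-+-diagonals a₀ a₁ b₀ b₁) (*-distrib-+-diagonals c₀ c₁ d₀ d₁)
    (+-mono-≼ {a₀ * b₀ + a₁ * b₁} {c₀ * d₀ + c₁ * d₁} {a₁ * b₀ + a₀ * b₁} {c₁ * d₀ + c₀ * d₁}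
      (+-mono-≼ {a₀ * b₀} {c₀ * d₀} {a₁ * b₁} {c₁ * d₁} h₀₀ h₁₁)
      (+-≼-of-*-≼ {a₁ * b₀} {a₀ * b₁} {c₁ * d₀} {c₀ * d₁}
        (*-nonNeg {c₁} {d₀} 0≼c₁ 0≼d₀) (*-nonNeg {c₀} {d₁} 0≼c₀ 0≼d₁) h₁₀ h₀₁
        (≼-resp-≈ {(a₁ * b₁) * (a₀ * b₀)} {_} {(c₁ * d₁) * (c₀ * d₀)}
          (*-interchange a₁ b₁ a₀ b₀) (*-interchange c₁ d₁ c₀ d₀)
          (*-mono-≼ {a₁ * b₁} {c₁ * d₁} {a₀ * b₀} {c₀ * d₀}
            (*-nonNeg {a₁} {b₁} 0≼a₁ 0≼b₁) (*-nonNeg {c₀} {d₀} 0≼c₀ 0≼d₀) h₁₁ h₀₀))))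

∑-nonNeg : ∀ {n} {f : Subset n → ℝ} → (∀ A → 0ℝ ≼ f A) → 0ℝ ≼ ∑ f
∑-nonNeg {zero}      0≼f = 0≼f []
∑-nonNeg {suc n} {f} 0≼f =
  +-nonNeg {∑ λ A → f (outside ∷ A)} {∑ λ A → f (inside ∷ A)}
    (∑-nonNeg λ A → 0≼f (outside ∷ A)) (∑-nonNeg λ A → 0≼f (inside ∷ A))

∑-+ : ∀ {n} (f g : Subset n → ℝ) → ∑ (λ A → f A + g A) ≈ ∑ f + ∑ g
∑-+ {zero}  f g k = refl
∑-+ {suc n} f g k = trans
  (cong₂ ℚ._+_ (∑-+ (λ A → f (outside ∷ A)) (λ A → g (outside ∷ A)) k)
               (∑-+ (λ A → f (inside ∷ A)) (λ A → g (inside ∷ A)) k))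
  (solve 4 (λ a b c d → (a :+ b) :+ (c :+ d) := (a :+ c) :+ (b :+ d)) refl
    (seq (∑ λ A → f (outside ∷ A)) k) (seq (∑ λ A → g (outside ∷ A)) k)
    (seq (∑ λ A → f (inside ∷ A)) k) (seq (∑ λ A → g (inside ∷ A)) k))

-- Complementation swaps the two halves of the sum.
∑-∁ : ∀ {n} (f : Subset n → ℝ) → ∑ (λ A → f (∁ A)) ≈ ∑ f
∑-∁ {zero}  f k = refl
∑-∁ {suc n} f k = trans
  (cong₂ ℚ._+_ (∑-∁ (λ A → f (inside ∷ A)) k) (∑-∁ (λ A → f (outside ∷ A)) k))
  (ℚ.+-comm (seq (∑ λ A → f (inside ∷ A)) k) (seq (∑ λ A → f (outside ∷ A)) k))

-- Converting reals that are equal definitionally but not syntactically unfolds their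
-- Cauchy moduli, which is prohibitively slow.  So such reals are related by _≈_, which
-- looks at the sequences only, and A ∪ B, A ∩ B are known up to _≡_ only.
four-functions : ∀ {n} {α β γ δ : Subset n → ℝ} →
  (∀ A → 0ℝ ≼ α A) → (∀ A → 0ℝ ≼ β A) → (∀ A → 0ℝ ≼ γ A) → (∀ A → 0ℝ ≼ δ A) →
  (∀ A B {C D} → A ∪ B ≡ C → A ∩ B ≡ D → α A * β B ≼ γ C * δ D) →
  ∑ α * ∑ β ≼ ∑ γ * ∑ δ
four-functions {zero} {α} {β} {γ} {δ} 0≼α 0≼β 0≼γ 0≼δ h =
  ≼-resp-≈ {α [] * β []} {_} {γ [] * δ []} (λ _ → refl) (λ _ → refl) (h [] [] refl refl)
four-functions {suc n} {α} {β} {γ} {δ} 0≼α 0≼β 0≼γ 0≼δ h =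
  ≼-resp-≈ {∑ (merge α) * ∑ (merge β)} {_} {∑ (merge γ) * ∑ (merge δ)}
    (λ k → cong₂ ℚ._*_ (∑-merge α k) (∑-merge β k))
    (λ k → cong₂ ℚ._*_ (∑-merge γ k) (∑-merge δ k))
    (four-functions {α = merge α} {merge β} {merge γ} {merge δ}
      (merge-nonNeg {α} 0≼α) (merge-nonNeg {β} 0≼β) (merge-nonNeg {γ} 0≼γ) (merge-nonNeg {δ} 0≼δ)
      merge-h)
  where
  -- Summing out the first element shrinks the ground set by one for the induction.
  merge : (Subset (suc n) → ℝ) → Subset n → ℝ
  merge f A = f (outside ∷ A) + f (inside ∷ A)

  ∑-merge : ∀ f → ∑ (merge f) ≈ ∑ f
  ∑-merge f = ∑-+ (λ A → f (outside ∷ A)) (λ A → f (inside ∷ A))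

  merge-nonNeg : ∀ {f} → (∀ A → 0ℝ ≼ f A) → ∀ A → 0ℝ ≼ merge f A
  merge-nonNeg {f} 0≼f A =
    +-nonNeg {f (outside ∷ A)} {f (inside ∷ A)} (0≼f (outside ∷ A)) (0≼f (inside ∷ A))

  -- For fixed `A` and `B` this is the one-point case in the first element, which lies outside the
  -- union only if outside both sets, and inside the intersection only if inside both.
  merge-h : ∀ A B {C D} → A ∪ B ≡ C → A ∩ B ≡ D → merge α A * merge β B ≼ merge γ C * merge δ D
  merge-h A B {C} {D} A∪B≡C A∩B≡D = ≼-resp-≈
    {(α (outside ∷ A) + α (inside ∷ A)) * (β (outside ∷ B) + β (inside ∷ B))} {_}
    {(γ (outside ∷ C) + γ (inside ∷ C)) * (δ (outside ∷ D) + δ (inside ∷ D))}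
    (λ _ → refl) (λ _ → refl)
    (four-functions-one-point
      {α (outside ∷ A)} {α (inside ∷ A)} {β (outside ∷ B)} {β (inside ∷ B)}
      {γ (outside ∷ C)} {γ (inside ∷ C)} {δ (outside ∷ D)} {δ (inside ∷ D)}
      (0≼α (inside ∷ A)) (0≼β (inside ∷ B))
      (0≼γ (outside ∷ C)) (0≼γ (inside ∷ C)) (0≼δ (outside ∷ D)) (0≼δ (inside ∷ D))
      (h (outside ∷ A) (outside ∷ B) (cong (outside ∷_) A∪B≡C) (cong (outside ∷_) A∩B≡D))
      (h (outside ∷ A) (inside ∷ B) (cong (inside ∷_) A∪B≡C) (cong (outside ∷_) A∩B≡D))
      (h (inside ∷ A) (outside ∷ B) (cong (inside ∷_) A∪B≡C) (cong (outside ∷_) A∩B≡D))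
      (h (inside ∷ A) (inside ∷ B) (cong (inside ∷_) A∪B≡C) (cong (inside ∷_) A∩B≡D)))

-- Sums over complementary pairs.

∑-≼-of-* : ∀ {n} {f g : Subset n → ℝ} →
  (∀ A → 0ℝ ≼ f A) → (∀ A → 0ℝ ≼ g A) →
  (∀ A B {C D} → A ∪ B ≡ C → A ∩ B ≡ D → f A * f (∁ B) ≼ g C * g (∁ D)) →
  ∑ f ≼ ∑ g
∑-≼-of-* {f = f} {g} 0≼f 0≼g h =
  square-cancel-≼ {∑ f} {∑ g} (∑-nonNeg 0≼f) (∑-nonNeg 0≼g)
    (≼-resp-≈ {∑ f * ∑ (λ A → f (∁ A))} {_} {∑ g * ∑ (λ A → g (∁ A))}
      (λ k → cong (seq (∑ f) k ℚ.*_) (∑-∁ f k))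
      (λ k → cong (seq (∑ g) k ℚ.*_) (∑-∁ g k))
      (four-functions {α = f} {λ A → f (∁ A)} {g} {λ A → g (∁ A)}
        0≼f (λ A → 0≼f (∁ A)) 0≼g (λ A → 0≼g (∁ A)) h))

theorem2p2 : (n : ℕ) → .{{_ : NonZero n}} →
    (α β γ δ : Subset n → ℝ) →
    (∀ A → 0ℝ ≤ α A) → (∀ A → 0ℝ ≤ β A) →
    (∀ A → 0ℝ ≤ γ A) → (∀ A → 0ℝ ≤ δ A) →
    (∀ A B → α A * β B ≤ γ (A ∪ B) * δ (A ∩ B)) →
    ∑ (λ A → α A * β (∁ A)) ≤ ∑ (λ C → γ C * δ (∁ C))
theorem2p2 n α β γ δ 0≤α 0≤β 0≤γ 0≤δ h = unwrap
  (∑-≼-of-* {f = λ A → α A * β (∁ A)} {λ C → γ C * δ (∁ C)}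
    (λ A → *-nonNeg {α A} {β (∁ A)} (0≼α A) (0≼β (∁ A)))
    (λ C → *-nonNeg {γ C} {δ (∁ C)} (0≼γ C) (0≼δ (∁ C)))
    products)
  where
  BA = ∪-∩-booleanAlgebra n

  0≼α = λ A → wrap {0ℝ} {α A} (0≤α A)
  0≼β = λ A → wrap {0ℝ} {β A} (0≤β A)
  0≼γ = λ A → wrap {0ℝ} {γ A} (0≤γ A)
  0≼δ = λ A → wrap {0ℝ} {δ A} (0≤δ A)

  αβ≼γδ : ∀ A B {C D} → A ∪ B ≡ C → A ∩ B ≡ D → α A * β B ≼ γ C * δ D
  αβ≼γδ A B refl refl = wrap (h A B)

  products : ∀ A B {C D} → A ∪ B ≡ C → A ∩ B ≡ D →
    (α A * β (∁ A)) * (α (∁ B) * β (∁ (∁ B))) ≼ (γ C * δ (∁ C)) * (γ (∁ D) * δ (∁ (∁ D)))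
  products A B {C} {D} A∪B≡C A∩B≡D = ≼-resp-≈
    {(α A * β (∁ (∁ B))) * (α (∁ B) * β (∁ A))} {_}
    {(γ C * δ (∁ (∁ D))) * (γ (∁ D) * δ (∁ C))}
    (*-interchange (α A) (β (∁ (∁ B))) (α (∁ B)) (β (∁ A)))
    (*-interchange (γ C) (δ (∁ (∁ D))) (γ (∁ D)) (δ (∁ C)))
    (*-mono-≼
      {α A * β (∁ (∁ B))} {γ C * δ (∁ (∁ D))} {α (∁ B) * β (∁ A)} {γ (∁ D) * δ (∁ C)}
      (*-nonNeg {α A} {β (∁ (∁ B))} (0≼α A) (0≼β (∁ (∁ B))))
      (*-nonNeg {γ (∁ D)} {δ (∁ C)} (0≼γ (∁ D)) (0≼δ (∁ C)))
      -- The double complements come from evaluating the summands at `∁ B` and `∁ D`; involutivity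
      -- removes them inside the set equations.
      (αβ≼γδ A (∁ (∁ B))
        (trans (cong (A ∪_) (¬-involutive BA B)) A∪B≡C)
        (trans (cong (A ∩_) (¬-involutive BA B)) (trans A∩B≡D (sym (¬-involutive BA D)))))
      -- By De Morgan the union of the complements is `∁ D` and their intersection is `∁ C`.
      (αβ≼γδ (∁ B) (∁ A)
        (trans (∪-comm (∁ B) (∁ A)) (trans (sym (deMorgan₁ BA A B)) (cong ∁ A∩B≡D)))
        (trans (∩-comm (∁ B) (∁ A)) (trans (sym (deMorgan₂ BA A B)) (cong ∁ A∪B≡C)))))
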